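{- There exists an absolute constant $C>0$ such that for every integer $k\ge 1$ and every finite undirected unweighted graph $G$ whose edge set can be covered by at most $k$ shortest paths (i.e., there are shortest paths $P_1,\dots,P_m$ of $G$, $m\le k$, with $E(G)=\bigcup_i E(P_i)$), the pathwidth of $G$ satisfies $\operatorname{pw}(G)\le C\cdot 3^k$.
   Context: A path decomposition of $G=(V,E)$ is a sequence $(X_1,\dots,X_q)$ of subsets of $V$ such that every edge has both endpoints in some $X_i$, and for every vertex $x$ the indices $i$ with $x\in X_i$ form a contiguous interval. Its width is $\max_i |X_i|-1$, and $\operatorname{pw}(G)$ is the minimum width of a path decomposition of $G$. A shortest path is a path between two vertices whose number of edges equals their distance in $G$. -}

module Defs where

open import Data.Nat using (ℕ; zero; suc; _+_; _*_; _^_; _≤_; _<_)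
open import Data.Fin using (Fin)
open import Data.Fin.Subset using (Subset; _∈_; ∣_∣)
open import Data.Bool using (Bool; true; false)
open import Data.List using (List; []; _∷_; length)
open import Data.List.Relation.Unary.All using (All)
open import Data.List.Relation.Unary.Any using (Any)
open import Data.List.Relation.Unary.Unique.Propositional using (Unique)
open import Data.Product using (Σ; _×_; _,_; ∃)
open import Data.Sum using (_⊎_)
open import Relation.Binary.PropositionalEquality using (_≡_)
open import Relation.Nullary using (¬_)
open import Data.Empty using (⊥)

record Graph : Set where
  field
    n     : ℕ
    adj   : Fin n → Fin n → Bool
    sym   : ∀ u v → adj u v ≡ adj v u
    irrefl : ∀ u → adj u u ≡ false

open Graph public

Adj : (G : Graph) → Fin (n G) → Fin (n G) → Set
Adj G u v = adj G u v ≡ true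

data Walk (G : Graph) : Fin (n G) → Fin (n G) → ℕ → Set where
  [_]  : (u : Fin (n G)) → Walk G u u zero
  _∷⟨_⟩_ : ∀ {w v ℓ} (u : Fin (n G)) → Adj G u w → Walk G w v ℓ → Walk G u v (suc ℓ)

vertices : ∀ {G u v ℓ} → Walk G u v ℓ → List (Fin (n G))
vertices [ u ] = u ∷ []
vertices (u ∷⟨ _ ⟩ p) = u ∷ vertices p

IsPath : ∀ {G u v ℓ} → Walk G u v ℓ → Set
IsPath p = Unique (vertices p)

IsShortestPath : ∀ {G u v ℓ} → Walk G u v ℓ → Set
IsShortestPath {G} {u} {v} {ℓ} p =
  IsPath p × (∀ {ℓ'} → Walk G u v ℓ' → ℓ ≤ ℓ')

EdgeOf : ∀ {G u v ℓ} → Fin (n G) → Fin (n G) → Walk G u v ℓ → Set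
EdgeOf x y [ _ ] = ⊥
EdgeOf {G} x y (u ∷⟨ _ ⟩ (_∷⟨_⟩_ {w = w'} w a p)) =
  ((x ≡ u × y ≡ w) ⊎ (x ≡ w × y ≡ u)) ⊎ EdgeOf x y (w ∷⟨ a ⟩ p)
EdgeOf {G} x y (u ∷⟨ _ ⟩ [ w ]) = (x ≡ u × y ≡ w) ⊎ (x ≡ w × y ≡ u)

record ShortestPath (G : Graph) : Set where
  field
    start end : Fin (n G)
    len       : ℕ
    walk      : Walk G start end len
    shortest  : IsShortestPath walk

-- The edge set of G is covered by the given list of shortest paths.
-- (Edges of paths in G are edges of G, so this gives E(G) = ⋃ E(P_i).)
CoversEdges : (G : Graph) → List (ShortestPath G) → Set
CoversEdges G Ps = ∀ u v → Adj G u v →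
  Any (λ P → EdgeOf u v (ShortestPath.walk P)) Ps

record PathDecomposition (G : Graph) : Set where
  field
    q     : ℕ
    bag   : Fin q → Subset (n G)
    edge-covered : ∀ u v → Adj G u v → ∃ λ i → u ∈ bag i × v ∈ bag i
    vertex-covered : ∀ x → ∃ λ i → x ∈ bag i
    contiguous : ∀ x (i j l : Fin q) →
      Data.Fin._≤_ i j → Data.Fin._≤_ j l → x ∈ bag i → x ∈ bag l → x ∈ bag j

WidthAtMost : ∀ {G} → PathDecomposition G → ℕ → Set
WidthAtMost D w = ∀ i → ∣ PathDecomposition.bag D i ∣ ≤ suc w

PathwidthAtMost : Graph → ℕ → Set
PathwidthAtMost G w = Σ (PathDecomposition G) λ D → WidthAtMost D w

{-# OPTIONS --safe #-}
module Submission where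

-- Colour the given paths and fix a root a. A geodesic from a can be rerouted so that it repeatedly
-- runs along one path P, until it meets paths that are still needed further on; it then turns into
-- the one of them that it leaves last, and none of the paths through the turning point is ever
-- needed again. Hence, if r of the remaining m paths pass through the current vertex, a vertex at
-- prescribed distance is found among 1 + 2r continuations with m − r remaining paths, and
-- (1 + 2r) 3^(m − r) ≤ 3^m bounds the size of each BFS layer. Two consecutive layers form a bag; the
-- layerings of different components, each from its least vertex, are put one after the other.

open import Defs
open import Data.Nat using (ℕ; zero; suc; _+_; _∸_; _*_; _^_; _≤_; _<_; z≤n; s≤s; z<s; s<s)
open import Data.Nat.Properties
open import Data.Fin using (Fin; toℕ; fromℕ<; combine)
open import Data.Fin.Properties
  using (any?; pigeonhole; toℕ<n; toℕ-fromℕ<; toℕ-injective; toℕ-combine; combine-injective)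
  renaming (_≟_ to _≟ᶠ_)
open import Data.Fin.Subset using (Subset; inside; outside; ∣_∣; ⁅_⁆; _∪_) renaming (_∈_ to _∈ₛ_; ⊥ to ∅)
open import Data.Fin.Subset.Properties using (∣⊥∣≡0; ∣⁅x⁆∣≡1; x∈⁅x⁆; x∈p∪q⁺; p⊆q⇒∣p∣≤∣q∣)
open import Data.Vec using ([]; _∷_; tabulate)
open import Data.Vec.Properties using ([]=⇒lookup; lookup⇒[]=; lookup∘tabulate)
open import Data.Bool using (true)
open import Data.Bool.Properties using () renaming (_≟_ to _≟ᵇ_)
open import Data.List using (List; []; _∷_; _++_; length; filter; concatMap)
open import Data.List.Properties using (length-++)
open import Data.List.Membership.Propositional using (_∈_; find; lose)
open import Data.List.Membership.Propositional.Properties using (∈-++⁺ˡ; ∈-++⁺ʳ; ∈-concatMap⁺; ∈-filter⁺; ∈-filter⁻)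
open import Data.List.Relation.Unary.Any as Any using (Any; here; there)
open import Data.List.Relation.Unary.Any.Properties using (concatMap⁺)
open import Data.Product using (Σ; ∃; ∃₂; _×_; _,_; proj₁; proj₂)
open import Data.Sum using (_⊎_; inj₁; inj₂)
open import Data.Unit using (⊤; tt)
open import Function using (_∘_; const)
open import Relation.Nullary using (¬?; Dec; yes; no; does; contradiction; map′; _×-dec_; _⊎-dec_)
open import Relation.Nullary.Decidable using (dec-true)
open import Relation.Unary using (Decidable)
import Relation.Binary.PropositionalEquality as ≡
open ≡ using (_≡_; refl; cong; subst)

-- Least witnesses and cardinalities of finite subsets

least : ∀ {P : ℕ → Set} → Decidable P → ∀ m → P m → ∃ λ k → P k × (∀ j → P j → k ≤ j)
least P? zero p = 0 , p , λ _ _ → z≤n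
least P? (suc m) p with P? 0
... | yes p₀ = 0 , p₀ , λ _ _ → z≤n
... | no ¬p₀ with least (P? ∘ suc) m p
...   | k , pk , min = suc k , pk , λ where
        zero p₀ → contradiction p₀ ¬p₀
        (suc j) pj → s≤s (min j pj)

∣p∪q∣≤∣p∣+∣q∣ : ∀ {m} (p q : Subset m) → ∣ p ∪ q ∣ ≤ ∣ p ∣ + ∣ q ∣
∣p∪q∣≤∣p∣+∣q∣ [] [] = z≤n
∣p∪q∣≤∣p∣+∣q∣ (inside ∷ p) (inside ∷ q) =
  s≤s (≤-trans (∣p∪q∣≤∣p∣+∣q∣ p q) (+-monoʳ-≤ ∣ p ∣ (n≤1+n ∣ q ∣)))
∣p∪q∣≤∣p∣+∣q∣ (inside ∷ p) (outside ∷ q) = s≤s (∣p∪q∣≤∣p∣+∣q∣ p q)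
∣p∪q∣≤∣p∣+∣q∣ (outside ∷ p) (inside ∷ q) =
  ≤-trans (s≤s (∣p∪q∣≤∣p∣+∣q∣ p q)) (≤-reflexive (≡.sym (+-suc ∣ p ∣ ∣ q ∣)))
∣p∪q∣≤∣p∣+∣q∣ (outside ∷ p) (outside ∷ q) = ∣p∪q∣≤∣p∣+∣q∣ p q

fromList : ∀ {m} → List (Fin m) → Subset m
fromList [] = ∅
fromList (x ∷ xs) = ⁅ x ⁆ ∪ fromList xs

∣fromList∣≤length : ∀ {m} (xs : List (Fin m)) → ∣ fromList xs ∣ ≤ length xs
∣fromList∣≤length {m} [] = ≤-reflexive (∣⊥∣≡0 m)
∣fromList∣≤length (x ∷ xs) =
  ≤-trans (∣p∪q∣≤∣p∣+∣q∣ ⁅ x ⁆ (fromList xs))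
          (+-mono-≤ (≤-reflexive (∣⁅x⁆∣≡1 x)) (∣fromList∣≤length xs))

∈-fromList : ∀ {m} {x : Fin m} {xs} → x ∈ xs → x ∈ₛ fromList xs
∈-fromList (here refl) = x∈p∪q⁺ (inj₁ (x∈⁅x⁆ _))
∈-fromList (there x∈xs) = x∈p∪q⁺ (inj₂ (∈-fromList x∈xs))

∣p∣≤length : ∀ {m} {p : Subset m} (xs : List (Fin m)) → (∀ x → x ∈ₛ p → x ∈ xs) → ∣ p ∣ ≤ length xs
∣p∣≤length xs p⊆xs = ≤-trans (p⊆q⇒∣p∣≤∣q∣ (∈-fromList ∘ p⊆xs _)) (∣fromList∣≤length xs)

comprehension : ∀ {m} {P : Fin m → Set} → Decidable P → Subset m
comprehension P? = tabulate (does ∘ P?)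

∈-comprehension⁺ : ∀ {m} {P : Fin m → Set} (P? : Decidable P) {x} → P x → x ∈ₛ comprehension P?
∈-comprehension⁺ P? {x} px =
  lookup⇒[]= x _ (≡.trans (lookup∘tabulate (does ∘ P?) x) (dec-true (P? x) px))

∈-comprehension⁻ : ∀ {m} {P : Fin m → Set} (P? : Decidable P) {x} → x ∈ₛ comprehension P? → P x
∈-comprehension⁻ P? {x} x∈ with P? x | ≡.trans (≡.sym (lookup∘tabulate (does ∘ P?) x)) ([]=⇒lookup x∈)
... | yes px | _ = px
... | no _ | ()

length-concatMap-≤ : ∀ {A B : Set} (f : A → List B) {b} → (∀ x → length (f x) ≤ b) →
  ∀ xs → length (concatMap f xs) ≤ length xs * b
length-concatMap-≤ f f≤b [] = z≤n
length-concatMap-≤ f f≤b (x ∷ xs) =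
  ≤-trans (≤-reflexive (length-++ (f x))) (+-mono-≤ (f≤b x) (length-concatMap-≤ f f≤b xs))

-- Walks and geodesics

module _ {G : Graph} where

  private
    V : Set
    V = Fin (n G)

  infixr 5 _++ʷ_

  _++ʷ_ : ∀ {u v w : V} {k m} → Walk G u v k → Walk G v w m → Walk G u w (k + m)
  [ _ ] ++ʷ q = q
  (u ∷⟨ a ⟩ p) ++ʷ q = u ∷⟨ a ⟩ (p ++ʷ q)

  Adj-sym : ∀ {u v : V} → Adj G u v → Adj G v u
  Adj-sym {u} {v} a = ≡.trans (sym G v u) a

  snoc : ∀ {u v w : V} {k} → Walk G u v k → Adj G v w → Walk G u w (suc k)
  snoc [ u ] b = u ∷⟨ b ⟩ [ _ ]
  snoc (u ∷⟨ a ⟩ p) b = u ∷⟨ a ⟩ snoc p b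

  reverseʷ : ∀ {u v : V} {k} → Walk G u v k → Walk G v u k
  reverseʷ [ u ] = [ u ]
  reverseʷ (u ∷⟨ a ⟩ p) = snoc (reverseʷ p) (Adj-sym a)

  AdjacentUpTo : ℕ → (ℕ → V) → Set
  AdjacentUpTo m ρ = ∀ j → j < m → Adj G (ρ j) (ρ (suc j))

  run : ∀ m (ρ : ℕ → V) → AdjacentUpTo m ρ → Walk G (ρ 0) (ρ m) m
  run zero ρ _ = [ ρ 0 ]
  run (suc m) ρ a = ρ 0 ∷⟨ a 0 z<s ⟩ run m (ρ ∘ suc) (λ j j<m → a (suc j) (s<s j<m))

  -- Past its end, a walk stays at its last vertex.
  at : ∀ {u v : V} {k} → Walk G u v k → ℕ → V
  at [ u ] _ = u
  at (u ∷⟨ _ ⟩ p) zero = u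
  at (u ∷⟨ _ ⟩ p) (suc i) = at p i

  at-start : ∀ {u v : V} {k} (p : Walk G u v k) → at p 0 ≡ u
  at-start [ _ ] = refl
  at-start (_ ∷⟨ _ ⟩ _) = refl

  at-adjacent : ∀ {u v : V} {k} (p : Walk G u v k) → AdjacentUpTo k (at p)
  at-adjacent (u ∷⟨ a ⟩ p) zero _ = subst (Adj G u) (≡.sym (at-start p)) a
  at-adjacent (u ∷⟨ a ⟩ p) (suc i) (s<s i<k) = at-adjacent p i i<k

  takeʷ : ∀ {u v : V} {k} (p : Walk G u v k) i → i ≤ k → Walk G u (at p i) i
  takeʷ [ u ] zero _ = [ u ]
  takeʷ (u ∷⟨ a ⟩ p) zero _ = [ u ]
  takeʷ (u ∷⟨ a ⟩ p) (suc i) (s≤s i≤k) = u ∷⟨ a ⟩ takeʷ p i i≤k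

  dropʷ : ∀ {u v : V} {k} (p : Walk G u v k) i → Walk G (at p i) v (k ∸ i)
  dropʷ [ u ] zero = [ u ]
  dropʷ [ u ] (suc _) = [ u ]
  dropʷ (u ∷⟨ a ⟩ p) zero = u ∷⟨ a ⟩ p
  dropʷ (u ∷⟨ a ⟩ p) (suc i) = dropʷ p i

  Geodesic : V → V → ℕ → Set
  Geodesic u v k = ∀ {m} → Walk G u v m → k ≤ m

  -- A shorter walk between the two positions, spliced in place of the segment, would shorten `p`.
  -- The end is written `m + i` to match the forward ray in `rays`, whose value at 0 then reduces to
  -- `at p i`.
  segment-geodesic : ∀ {u v : V} {k} (p : Walk G u v k) → Geodesic u v k →
    ∀ {i m} → m + i ≤ k → Geodesic (at p i) (at p (m + i)) m
  segment-geodesic {k = k} p geo {i} {m} m+i≤k {t} w =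
    +-cancelʳ-≤ e m t (+-cancelˡ-≤ i (m + e) (t + e) (begin
      i + (m + e)                  ≡⟨ +-assoc i m e ⟨
      i + m + e                    ≡⟨ cong (_+ e) (+-comm i m) ⟩
      m + i + e                    ≡⟨ m+[n∸m]≡n m+i≤k ⟩
      k                            ≤⟨ geo (takeʷ p i (≤-trans (m≤n+m i m) m+i≤k) ++ʷ w ++ʷ dropʷ p (m + i)) ⟩
      i + (t + e)                  ∎))
    where
    open ≤-Reasoning
    e = k ∸ (m + i)

  -- Candidate vertices and their number

  On : ShortestPath G → V → Set
  On P z = ∃ λ i → i < suc (ShortestPath.len P) × at (ShortestPath.walk P) i ≡ z

  on? : ∀ P z → Dec (On P z)
  on? P z = anyUpTo? (λ i → at (ShortestPath.walk P) i ≟ᶠ z) (suc (ShortestPath.len P))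

  EdgeOf⇒at : ∀ {x y u v : V} {k} (p : Walk G u v k) → EdgeOf x y p →
    (∃ λ i → i < suc k × at p i ≡ x) × (∃ λ j → j < suc k × at p j ≡ y)
  EdgeOf⇒at (u ∷⟨ _ ⟩ [ w ]) (inj₁ (refl , refl)) = (0 , z<s , refl) , (1 , s<s z<s , refl)
  EdgeOf⇒at (u ∷⟨ _ ⟩ [ w ]) (inj₂ (refl , refl)) = (1 , s<s z<s , refl) , (0 , z<s , refl)
  EdgeOf⇒at (u ∷⟨ _ ⟩ (w ∷⟨ a ⟩ p)) (inj₁ (inj₁ (refl , refl))) = (0 , z<s , refl) , (1 , s<s z<s , refl)
  EdgeOf⇒at (u ∷⟨ _ ⟩ (w ∷⟨ a ⟩ p)) (inj₁ (inj₂ (refl , refl))) = (1 , s<s z<s , refl) , (0 , z<s , refl)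
  EdgeOf⇒at (u ∷⟨ _ ⟩ (w ∷⟨ a ⟩ p)) (inj₂ e) with EdgeOf⇒at (w ∷⟨ a ⟩ p) e
  ... | (i , i< , eqᵢ) , (j , j< , eqⱼ) = (suc i , s<s i< , eqᵢ) , (suc j , s<s j< , eqⱼ)

  -- The two directions in which `P` leaves `z`. Both are total functions: beyond an end of `P` they
  -- stay there, forwards by the convention of `at`, backwards by truncated subtraction.
  rays : V → ShortestPath G → List (ℕ → V)
  rays z P with on? P z
  ... | yes (i , _) = (λ j → at (ShortestPath.walk P) (j + i)) ∷ (λ j → at (ShortestPath.walk P) (i ∸ j)) ∷ []
  ... | no _ = []

  avoiding : V → List (ShortestPath G) → List (ShortestPath G)
  avoiding z = filter (λ P → ¬? (on? P z))

  -- ρ is the ray being followed and R holds the paths that may still be turned into.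
  candidates : List (ShortestPath G) → (ℕ → V) → ℕ → List V
  candidates R ρ zero = ρ 0 ∷ []
  candidates R ρ (suc d) =
    candidates R′ (ρ ∘ suc) d ++
    concatMap (λ ρ′ → candidates R′ (ρ′ ∘ suc) d) (concatMap (rays (ρ 0)) R)
    where R′ = avoiding (ρ 0) R

  -- Induction on `R`. A path through `z` adds two rays but drops out of `avoiding z R`, and
  -- `3 + r ≤ 3 * (1 + r)`; a path missing `z` multiplies both sides by 3. The leading `suc` counts
  -- the option of staying on the current ray.
  branching-bound : ∀ z R → suc (length (concatMap (rays z) R)) * 3 ^ length (avoiding z R) ≤ 3 ^ length R
  branching-bound z [] = ≤-refl
  branching-bound z (P ∷ R) with on? P z
  ... | yes _ = begin
    (3 + r) * t      ≤⟨ *-monoˡ-≤ t (+-monoʳ-≤ 3 (m≤n*m r 3)) ⟩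
    (3 + 3 * r) * t  ≡⟨ cong (_* t) (*-suc 3 r) ⟨
    3 * suc r * t    ≡⟨ *-assoc 3 (suc r) t ⟩
    3 * (suc r * t)  ≤⟨ *-monoʳ-≤ 3 (branching-bound z R) ⟩
    3 * 3 ^ length R ∎
    where
    open ≤-Reasoning
    r = length (concatMap (rays z) R)
    t = 3 ^ length (avoiding z R)
  ... | no _ = begin
    suc r * (3 * t)  ≡⟨ *-assoc (suc r) 3 t ⟨
    suc r * 3 * t    ≡⟨ cong (_* t) (*-comm (suc r) 3) ⟩
    3 * suc r * t    ≡⟨ *-assoc 3 (suc r) t ⟩
    3 * (suc r * t)  ≤⟨ *-monoʳ-≤ 3 (branching-bound z R) ⟩
    3 * 3 ^ length R ∎
    where
    open ≤-Reasoning
    r = length (concatMap (rays z) R)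
    t = 3 ^ length (avoiding z R)

  -- All continuations share the same remaining list `R′`, so the induction hypothesis gives each
  -- the bound `3 ^ length R′`, and `branching-bound` absorbs their number.
  length-candidates : ∀ d R ρ → length (candidates R ρ d) ≤ 3 ^ length R
  length-candidates zero R ρ = m^n>0 3 (length R)
  length-candidates (suc d) R ρ = begin
    length (stay ++ turn)                       ≡⟨ length-++ stay ⟩
    length stay + length turn                   ≤⟨ +-mono-≤ (length-candidates d R′ (ρ ∘ suc))
                                                     (length-concatMap-≤ _ (λ ρ′ → length-candidates d R′ (ρ′ ∘ suc))
                                                       (concatMap (rays (ρ 0)) R)) ⟩
    suc (length (concatMap (rays (ρ 0)) R)) * 3 ^ length R′  ≤⟨ branching-bound (ρ 0) R ⟩
    3 ^ length R                                ∎
    where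
    open ≤-Reasoning
    R′ = avoiding (ρ 0) R
    stay = candidates R′ (ρ ∘ suc) d
    turn = concatMap (λ ρ′ → candidates R′ (ρ′ ∘ suc) d) (concatMap (rays (ρ 0)) R)

  -- Rerouting geodesics along the covering paths

  Covered : ∀ {u v : V} {k} → List (ShortestPath G) → Walk G u v k → Set
  Covered R [ _ ] = ⊤
  Covered R (_∷⟨_⟩_ {w = w} u _ p) = Any (λ P → On P u × On P w) R × Covered R p

  covers⇒Covered : ∀ {Ps} → CoversEdges G Ps → ∀ {u v : V} {k} (p : Walk G u v k) → Covered Ps p
  covers⇒Covered cov [ _ ] = tt
  covers⇒Covered cov (u ∷⟨ a ⟩ p) =
    Any.map (λ {P} → EdgeOf⇒at (ShortestPath.walk P)) (cov u _ a) , covers⇒Covered cov p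

  -- The tail is treated first, so the edge found is the last one whose chosen covering path passes
  -- through `z`, and `y` is its far end. The length `suc p` records that reaching `y` takes at
  -- least one step.
  split-last : ∀ {u v : V} {e} R z (Q : Walk G u v e) → Covered R Q →
    Covered (avoiding z R) Q ⊎
    Σ V λ y → ∃₂ λ p q → suc p + q ≡ e × Walk G u y (suc p) ×
      Any (λ P → On P z × On P y) R × Σ (Walk G y v q) (Covered (avoiding z R))
  split-last R z [ _ ] _ = inj₁ tt
  split-last R z (u ∷⟨ a ⟩ Q) (c , cs) with split-last R z Q cs
  ... | inj₂ (y , p , q , eq , W , P , Q′) = inj₂ (y , suc p , q , cong suc eq , u ∷⟨ a ⟩ W , P , Q′)
  ... | inj₁ cs′ with find c
  ...   | P , P∈R , onu , onw with on? P z
  ...     | yes onz = inj₂ (_ , 0 , _ , refl , u ∷⟨ a ⟩ [ _ ] , lose P∈R (onz , onw) , Q , cs′)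
  ...     | no ¬onz = inj₁ (lose (∈-filter⁺ (λ P → ¬? (on? P z)) P∈R ¬onz) (onu , onw) , cs′)

  -- The segment of `P` between `z` and `y` is itself a geodesic, so its length is exactly `m`; the
  -- ray to use depends on which vertex comes first on `P`.
  ray-towards : ∀ P {z y : V} {m} → On P z → On P y → Walk G z y m → Geodesic z y m →
    Any (λ ρ → ρ 0 ≡ z × ρ m ≡ y × AdjacentUpTo m ρ) (rays z P)
  ray-towards P {z} {y} {m} onz (j , j< , refl) W geo with on? P z
  ... | no ¬onz = contradiction onz ¬onz
  ... | yes (i , i< , refl) with ≤-total i j
  ...   | inj₁ i≤j = here (refl , ends , adjacent)
    where
    p = ShortestPath.walk P
    j≡ : (j ∸ i) + i ≡ j
    j≡ = m∸n+n≡m i≤j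
    adj′ : AdjacentUpTo (j ∸ i) (λ l → at p (l + i))
    adj′ l l< = at-adjacent p (l + i) (<-≤-trans (subst (l + i <_) j≡ (+-monoˡ-< i l<)) (≤-pred j<))
    m≡ : m ≡ j ∸ i
    m≡ = ≤-antisym
      (geo (subst (λ x → Walk G (at p i) (at p x) (j ∸ i)) j≡ (run (j ∸ i) _ adj′)))
      (segment-geodesic p (proj₂ (ShortestPath.shortest P)) {i} {j ∸ i} (subst (_≤ _) (≡.sym j≡) (≤-pred j<))
        (subst (λ x → Walk G (at p i) (at p x) m) (≡.sym j≡) W))
    ends : at p (m + i) ≡ at p j
    ends = cong (at p) (≡.trans (cong (_+ i) m≡) j≡)
    adjacent : AdjacentUpTo m (λ l → at p (l + i))
    adjacent = subst (λ x → AdjacentUpTo x (λ l → at p (l + i))) (≡.sym m≡) adj′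
  ...   | inj₂ j≤i = there (here (refl , ends , adjacent))
    where
    p = ShortestPath.walk P
    i≡ : (i ∸ j) + j ≡ i
    i≡ = m∸n+n≡m j≤i
    back : i ∸ (i ∸ j) ≡ j
    back = m∸[m∸n]≡n j≤i
    adj′ : AdjacentUpTo (i ∸ j) (λ l → at p (i ∸ l))
    -- As `l < i`, the position `i ∸ l` is the successor of `i ∸ suc l`, so this is an edge of `p`
    -- taken backwards.
    adj′ l l< = Adj-sym (subst (λ x → Adj G (at p (i ∸ suc l)) (at p x)) (≡.sym (+-∸-assoc 1 l<i))
      (at-adjacent p (i ∸ suc l) (<-≤-trans (≤-trans (≤-reflexive (≡.sym (+-∸-assoc 1 l<i))) (m∸n≤m i l)) (≤-pred i<))))
      where
      l<i : suc l ≤ i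
      l<i = ≤-trans l< (m∸n≤m i j)
    m≡ : m ≡ i ∸ j
    m≡ = ≤-antisym
      (geo (subst (λ x → Walk G (at p i) (at p x) (i ∸ j)) back (run (i ∸ j) _ adj′)))
      (segment-geodesic p (proj₂ (ShortestPath.shortest P)) {j} {i ∸ j} (subst (_≤ _) (≡.sym i≡) (≤-pred i<))
        (subst (λ x → Walk G (at p j) (at p x) m) (≡.sym i≡) (reverseʷ W)))
    ends : at p (i ∸ m) ≡ at p j
    ends = cong (at p) (≡.trans (cong (i ∸_) m≡) back)
    adjacent : AdjacentUpTo m (λ l → at p (i ∸ l))
    adjacent = subst (λ x → AdjacentUpTo x (λ l → at p (i ∸ l))) (≡.sym m≡) adj′

  -- Invariant: some geodesic from ρ 0 to v follows ρ for r steps and is then covered by R.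
  ∈-candidates : ∀ d R ρ r {v : V} {e} → r + e ≡ d → AdjacentUpTo r ρ →
    (Q : Walk G (ρ r) v e) → Covered R Q → Geodesic (ρ 0) v d → v ∈ candidates R ρ d
  ∈-candidates zero R ρ zero refl adj′ [ _ ] cov geo = here refl
  ∈-candidates (suc d) R ρ r {v} {e} eq adj′ Q cov geo with split-last R (ρ 0) Q cov
  -- With no steps left on `ρ`, the first edge of `Q` starts at `ρ 0`, so its covering path cannot
  -- avoid `ρ 0`.
  ∈-candidates (suc d) R ρ zero eq adj′ (_ ∷⟨ _ ⟩ _) cov geo | inj₁ (c , _)
    with find c
  ... | P , P∈ , onz , _ = contradiction onz (proj₂ (∈-filter⁻ (λ P → ¬? (on? P (ρ 0))) {xs = R} P∈))
  ∈-candidates (suc d) R ρ zero () adj′ [ _ ] cov geo | inj₁ _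
  -- No path through `ρ 0` is used later on: advance one step along `ρ`.
  ∈-candidates (suc d) R ρ (suc r) eq adj′ Q cov geo | inj₁ cov′ =
    ∈-++⁺ˡ (∈-candidates d (avoiding (ρ 0) R) (ρ ∘ suc) r (suc-injective eq)
      (λ j j< → adj′ (suc j) (s<s j<)) Q cov′ (λ w → ≤-pred (geo (ρ 0 ∷⟨ adj′ 0 z<s ⟩ w))))
  ∈-candidates (suc d) R ρ r {v} eq adj′ Q cov geo | inj₂ (y , p , q , refl , W , Ps , Q′ , cov′) =
    ∈-++⁺ʳ (candidates R′ (ρ ∘ suc) d) (∈-concatMap⁺ _ (Any.map turn (concatMap⁺ _ (Any.map toRay Ps))))
    where
    R′ = avoiding (ρ 0) R
    m = r + suc p
    total : suc (r + p + q) ≡ suc d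
    total = ≡.trans (cong (_+ q) (≡.sym (+-suc r p))) (≡.trans (+-assoc r (suc p) q) eq)
    to-y : Walk G (ρ 0) y (suc (r + p))
    to-y = subst (Walk G (ρ 0) y) (+-suc r p) (run r ρ adj′ ++ʷ W)
    geo-y : Geodesic (ρ 0) y (suc (r + p))
    geo-y {t} w = +-cancelʳ-≤ q _ t (≤-trans (≤-reflexive total) (geo (w ++ʷ Q′)))
    toRay : ∀ {P} → On P (ρ 0) × On P y →
      Any (λ ρ′ → ρ′ 0 ≡ ρ 0 × ρ′ (suc (r + p)) ≡ y × AdjacentUpTo (suc (r + p)) ρ′) (rays (ρ 0) P)
    toRay {P} (onz , ony) = ray-towards P onz ony to-y geo-y
    turn : ∀ {ρ′ : ℕ → V} → ρ′ 0 ≡ ρ 0 × ρ′ (suc (r + p)) ≡ y × AdjacentUpTo (suc (r + p)) ρ′ →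
      v ∈ candidates R′ (ρ′ ∘ suc) d
    turn {ρ′} (start≡ , refl , adj″) =
      -- After one step on the new ray, `r + p` steps remain to `y`, where the walk `Q′` covered by
      -- `R′` takes over.
      ∈-candidates d R′ (ρ′ ∘ suc) (r + p) (suc-injective total) (λ j j< → adj″ (suc j) (s<s j<)) Q′ cov′
        (λ w → ≤-pred (geo (subst (λ x → Walk G x v _) start≡ (ρ′ 0 ∷⟨ adj″ 0 z<s ⟩ w))))

  -- Distances, component roots and layers

  walk? : ∀ d (u v : V) → Dec (Walk G u v d)
  walk? zero u v = map′ (λ { refl → [ u ] }) (λ { [ _ ] → refl }) (u ≟ᶠ v)
  walk? (suc d) u v =
    map′ (λ (w , a , p) → u ∷⟨ a ⟩ p) (λ { (_∷⟨_⟩_ _ a p) → _ , a , p })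
      (any? λ w → (adj G u w ≟ᵇ true) ×-dec walk? d w v)

  Connected : V → V → Set
  Connected u v = ∃ (Walk G u v)

  geodesic : ∀ {u v} → Connected u v → ∃ λ d → Walk G u v d × Geodesic u v d
  geodesic {u} {v} (k , p) with least (λ d → walk? d u v) k p
  ... | d , q , min = d , q , λ {m} → min m

  -- Otherwise two of the `suc d` positions carry the same vertex, and cutting out the part between
  -- them gives a shorter walk. This makes connectedness a bounded search and lets depths live in
  -- `Fin (n G)`.
  geodesic-< : ∀ {u v : V} {d} → Walk G u v d → Geodesic u v d → d < n G
  geodesic-< {u} {v} {d} p geo = ≰⇒> λ n≤d →
    let i , j , i<j , eq = pigeonhole (s≤s n≤d) (at p ∘ toℕ)
        i≤d = ≤-pred (toℕ<n i)
        shortcut = takeʷ p (toℕ i) i≤d ++ʷ subst (λ x → Walk G x v (d ∸ toℕ j)) (≡.sym eq) (dropʷ p (toℕ j))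
    in <-irrefl refl (≤-<-trans (geo shortcut)
         (<-≤-trans (+-monoʳ-< (toℕ i) (∸-monoʳ-< i<j (≤-pred (toℕ<n j)))) (≤-reflexive (m+[n∸m]≡n i≤d))))

  connected? : ∀ u v → Dec (Connected u v)
  connected? u v = map′ (λ (d , _ , p) → d , p)
    (λ c → let d , p , geo = geodesic c in d , geodesic-< p geo , p)
    (anyUpTo? (λ d → walk? d u v) (n G))

  -- Indexed by numbers so that `least` selects the smallest vertex of the component.
  HasRoot : V → ℕ → Set
  HasRoot v k = Σ V λ u → toℕ u ≡ k × Connected u v

  abstract
    least-root : ∀ v → ∃ λ k → HasRoot v k × (∀ j → HasRoot v j → k ≤ j)
    least-root v = least (λ k → any? λ u → (toℕ u ≟ k) ×-dec connected? u v) (toℕ v) (v , refl , 0 , [ v ])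

  root : V → V
  root v = proj₁ (proj₁ (proj₂ (least-root v)))

  root-connected : ∀ v → Connected (root v) v
  root-connected v = proj₂ (proj₂ (proj₁ (proj₂ (least-root v))))

  root-minimal : ∀ {u v} → Connected u v → toℕ (root v) ≤ toℕ u
  root-minimal {u} {v} c with least-root v
  ... | _ , (_ , refl , _) , min = min (toℕ u) (u , refl , c)

  -- Each root is connected to both ends of the edge, so minimality applies in both directions.
  root-adjacent : ∀ {u v} → Adj G u v → root u ≡ root v
  root-adjacent {u} {v} a = toℕ-injective (≤-antisym
    (root-minimal (let k , p = root-connected v in suc k , snoc p (Adj-sym a)))
    (root-minimal (let k , p = root-connected u in suc k , snoc p a)))

  abstract
    root-geodesic : ∀ v → ∃ λ d → Walk G (root v) v d × Geodesic (root v) v d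
    root-geodesic v = geodesic (root-connected v)

  depth : V → ℕ
  depth v = proj₁ (root-geodesic v)

  depth-adjacent : ∀ {u v} → Adj G u v → depth v ≤ suc (depth u)
  depth-adjacent {u} {v} a =
    let _ , _ , geo = root-geodesic v
        _ , p , _ = root-geodesic u
    in geo (subst (λ r → Walk G r v (suc (depth u))) (root-adjacent a) (snoc p a))

  depth<n : ∀ v → depth v < n G
  depth<n v = let _ , p , geo = root-geodesic v in geodesic-< p geo

  -- Each root owns a block of `n G` consecutive numbers, which holds all depths of its component;
  -- different components therefore never share a level.
  level : V → Fin (n G * n G)
  level v = combine (root v) (fromℕ< (depth<n v))

  toℕ-level : ∀ v → toℕ (level v) ≡ n G * toℕ (root v) + depth v
  toℕ-level v = ≡.trans (toℕ-combine (root v) (fromℕ< (depth<n v))) (cong (n G * toℕ (root v) +_) (toℕ-fromℕ< (depth<n v)))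

  level-adjacent : ∀ {u v} → Adj G u v → toℕ (level v) ≤ suc (toℕ (level u))
  level-adjacent {u} {v} a = begin
    toℕ (level v)                         ≡⟨ toℕ-level v ⟩
    n G * toℕ (root v) + depth v          ≤⟨ +-monoʳ-≤ _ (depth-adjacent a) ⟩
    n G * toℕ (root v) + suc (depth u)    ≡⟨ +-suc _ (depth u) ⟩
    suc (n G * toℕ (root v) + depth u)    ≡⟨ cong (λ r → suc (n G * toℕ r + depth u)) (root-adjacent a) ⟨
    suc (n G * toℕ (root u) + depth u)    ≡⟨ cong suc (toℕ-level u) ⟨
    suc (toℕ (level u))                   ∎
    where open ≤-Reasoning

  level-injective : ∀ {u v} → toℕ (level u) ≡ toℕ (level v) → root u ≡ root v × depth u ≡ depth v
  level-injective {u} {v} eq =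
    let root≡ , depth≡ = combine-injective (root u) (fromℕ< (depth<n u)) (root v) (fromℕ< (depth<n v)) (toℕ-injective eq)
    in root≡ , ≡.trans (≡.sym (toℕ-fromℕ< (depth<n u))) (≡.trans (cong toℕ depth≡) (toℕ-fromℕ< (depth<n v)))

  ∈-candidates-root : ∀ {Ps} → CoversEdges G Ps → ∀ v → v ∈ candidates Ps (const (root v)) (depth v)
  ∈-candidates-root {Ps} cov v =
    let d , p , geo = root-geodesic v
    -- The constant ray is a placeholder: it is followed for 0 steps, and the whole geodesic plays
    -- the part of `Q`.
    in ∈-candidates d Ps (const (root v)) 0 refl (λ _ ()) p (covers⇒Covered cov p) geo

  -- Vertices on one level agree in root and depth, so a single candidate list contains them all.
  level-bound : ∀ {Ps} → CoversEdges G Ps → ∀ l →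
    ∃ λ xs → length xs ≤ 3 ^ length Ps × (∀ v → toℕ (level v) ≡ l → v ∈ xs)
  level-bound {Ps} cov l with any? (λ v → toℕ (level v) ≟ l)
  ... | no none = [] , z≤n , λ v eq → contradiction (v , eq) none
  ... | yes (u , refl) = candidates Ps (const (root u)) (depth u) , length-candidates (depth u) Ps _ , λ v eq →
    let root≡ , depth≡ = level-injective {v} {u} eq
    in ≡.subst₂ (λ r d → v ∈ candidates Ps (const r) d) root≡ depth≡ (∈-candidates-root cov v)

  -- The path decomposition and its width

  InBag : Fin (n G * n G) → V → Set
  InBag i v = toℕ (level v) ≡ toℕ i ⊎ toℕ (level v) ≡ suc (toℕ i)

  inBag? : ∀ i → Decidable (InBag i)
  inBag? i v = (toℕ (level v) ≟ toℕ i) ⊎-dec (toℕ (level v) ≟ suc (toℕ i))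

  -- As a pair of inequalities, membership confines `i` to an interval, from which contiguity
  -- follows by transitivity.
  InBag⇒bounds : ∀ {i v} → InBag i v → toℕ i ≤ toℕ (level v) × toℕ (level v) ≤ suc (toℕ i)
  InBag⇒bounds (inj₁ eq) = ≤-reflexive (≡.sym eq) , ≤-trans (≤-reflexive eq) (n≤1+n _)
  InBag⇒bounds (inj₂ eq) = ≤-trans (n≤1+n _) (≤-reflexive (≡.sym eq)) , ≤-reflexive eq

  bounds⇒InBag : ∀ {i v} → toℕ i ≤ toℕ (level v) → toℕ (level v) ≤ suc (toℕ i) → InBag i v
  bounds⇒InBag lo hi with m≤n⇒m<n∨m≡n lo
  ... | inj₁ i<l = inj₂ (≤-antisym hi i<l)
  ... | inj₂ i≡l = inj₁ (≡.sym i≡l)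

  levelDecomposition : PathDecomposition G
  levelDecomposition = record
    { q = n G * n G
    ; bag = λ i → comprehension (inBag? i)
    ; edge-covered = edge
    ; vertex-covered = λ x → level x , ∈-comprehension⁺ (inBag? (level x)) (inj₁ refl)
    ; contiguous = λ x i j l i≤j j≤l x∈i x∈l → ∈-comprehension⁺ (inBag? j) (bounds⇒InBag {j} {x}
        (≤-trans j≤l (proj₁ (InBag⇒bounds {l} {x} (∈-comprehension⁻ (inBag? l) x∈l))))
        (≤-trans (proj₂ (InBag⇒bounds {i} {x} (∈-comprehension⁻ (inBag? i) x∈i))) (s≤s i≤j)))
    }
    where
    edge : ∀ u v → Adj G u v → ∃ λ i → u ∈ₛ comprehension (inBag? i) × v ∈ₛ comprehension (inBag? i)
    -- The bag is indexed by the lower of the two levels; the other end lies at most one level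
    -- higher.
    edge u v a with ≤-total (toℕ (level u)) (toℕ (level v))
    ... | inj₁ u≤v = level u , ∈-comprehension⁺ (inBag? (level u)) (inj₁ refl) ,
      ∈-comprehension⁺ (inBag? (level u)) (bounds⇒InBag {level u} {v} u≤v (level-adjacent a))
    ... | inj₂ v≤u = level v ,
      ∈-comprehension⁺ (inBag? (level v)) (bounds⇒InBag {level v} {u} v≤u (level-adjacent (Adj-sym a))) ,
      ∈-comprehension⁺ (inBag? (level v)) (inj₁ refl)

  levelDecomposition-width : ∀ {Ps} → CoversEdges G Ps → WidthAtMost levelDecomposition (2 * 3 ^ length Ps)
  levelDecomposition-width {Ps} cov i with level-bound cov (toℕ i) | level-bound cov (suc (toℕ i))
  ... | xs , |xs|≤ , ∈xs | ys , |ys|≤ , ∈ys = begin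
    ∣ comprehension (inBag? i) ∣   ≤⟨ ∣p∣≤length (xs ++ ys) mem ⟩
    length (xs ++ ys)              ≡⟨ length-++ xs ⟩
    length xs + length ys          ≤⟨ +-mono-≤ |xs|≤ (≤-trans |ys|≤ (m≤m+n _ 0)) ⟩
    2 * 3 ^ length Ps              ≤⟨ n≤1+n _ ⟩
    suc (2 * 3 ^ length Ps)        ∎
    where
    open ≤-Reasoning
    mem : ∀ x → x ∈ₛ comprehension (inBag? i) → x ∈ xs ++ ys
    mem x x∈ with ∈-comprehension⁻ (inBag? i) x∈
    ... | inj₁ eq = ∈-++⁺ˡ (∈xs x eq)
    ... | inj₂ eq = ∈-++⁺ʳ xs (∈ys x eq)

theorem1 : Σ ℕ λ C → (0 < C) ×
    (∀ (k : ℕ) → 1 ≤ k → (G : Graph) → (Ps : List (ShortestPath G)) →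
    length Ps ≤ k → CoversEdges G Ps → PathwidthAtMost G (C * 3 ^ k))
-- The constant is 2 because a bag joins two layers, each of at most `3 ^ k` vertices.
theorem1 = 2 , z<s , λ k _ G Ps |Ps|≤k cov → levelDecomposition , λ i →
  ≤-trans (levelDecomposition-width cov i) (s≤s (*-monoʳ-≤ 2 (^-monoʳ-≤ 3 |Ps|≤k)))
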